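{- Let $n \ge 4$ be an even integer and let $T_{2n}(W)$ be the Toeplitz graph with vertex set $\{x_1,\dots,x_{2n}\}$ in which $x_i$ and $x_j$ are adjacent if and only if $|i-j|$ is odd or $|i-j| = n$. Then every resolving partition $\Sigma = \{S_1,\dots,S_k\}$ of $V(T_{2n}(W))$ satisfies $$k \ge \lceil 2\sqrt{n-1}\, \rceil.$$
   Context: $T_{2n}(W)$ is defined from $W = \{x_1, x_3, \dots, x_{2n-1}\} \cup \{x_n\}$: distinct vertices $x_i, x_j$ ($1\le i,j\le 2n$) are adjacent iff $|i-j| = t$ for some $x_t \in W$, i.e. iff $|i-j|$ is odd or equals $n$. For a connected graph $G$ with graph distance $d$, a vertex $v$ and a nonempty $S \subseteq V(G)$, put $d(v,S) = \min_{s\in S} d(v,s)$. For a partition $\Sigma = \{S_1,\dots,S_k\}$ of $V(G)$ into $k$ nonempty parts, the representation of $v$ is $r(v|\Sigma) = (d(v,S_1),\dots,d(v,S_k))$. $\Sigma$ is a resolving partition if $r(u|\Sigma) \ne r(v|\Sigma)$ for all distinct vertices $u,v$. -}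

module Defs where

open import Data.Nat using (ℕ; zero; suc; _*_; _≤_; _≤?_; ∣_-_∣; z≤n; s≤s)
open import Data.Nat.Properties
  using (≤-trans; n≤1+n; ≰⇒>; m≤n+m; *-mono-≤; *-monoʳ-≤; ∣-∣-comm)
open import Data.Nat.Divisibility using (_∤_)
open import Data.Fin using (Fin; toℕ)
open import Data.Product using (_×_; _,_; ∃-syntax)
open import Data.Sum using (_⊎_)
open import Data.Vec using (Vec; lookup)
open import Function using (_∘_)
open import Level using (0ℓ)
open import Relation.Binary using (Rel; Symmetric)
open import Relation.Binary.PropositionalEquality
  using (_≡_; _≢_; refl; sym; subst)
open import Relation.Nullary using (¬_; yes; no)
open import Relation.Unary using (Pred; _∈_; Satisfiable; _⊥_)

record SimpleGraph (V : Set) : Set₁ where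
  field
    _~_     : Rel V 0ℓ
    ~-sym   : Symmetric _~_
    ~-irr   : ∀ {v} → ¬ (v ~ v)

-- The vertex xᵢ (1 ≤ i ≤ m) is the element of Fin m with toℕ equal to i - 1;
-- the shift does not affect index differences.

Toeplitz : (m : ℕ) → Pred ℕ 0ℓ → SimpleGraph (Fin m)
Toeplitz m W = record
  { _~_   = λ i j → i ≢ j × ∣ toℕ i - toℕ j ∣ ∈ W
  ; ~-sym = λ {i} {j} (i≢j , w) →
      i≢j ∘ sym , subst W (∣-∣-comm (toℕ i) (toℕ j)) w
  ; ~-irr = λ (v≢v , _) → v≢v refl
  }

-- The index set {1, 3, …, 2n-1} ∪ {n}.  The bound 2n-1 is omitted: index
-- differences of vertices of T₂ₙ never exceed it.

W : ℕ → Pred ℕ 0ℓ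
W n t = 2 ∤ t ⊎ t ≡ n

T₂ₙ : (n : ℕ) → SimpleGraph (Fin (2 * n))
T₂ₙ n = Toeplitz (2 * n) (W n)

module _ {V : Set} (G : SimpleGraph V) where
  open SimpleGraph G

  data Walk : V → V → ℕ → Set where
    []  : ∀ {v} → Walk v v 0
    _∷_ : ∀ {u v w ℓ} → u ~ v → Walk v w ℓ → Walk u w (suc ℓ)

  -- Distances are given as relations: IsDistance u v d reads d(u,v) = d,
  -- IsSetDistance v S d reads d(v,S) = d, and IsRepresentation S v r reads
  -- r(v|Σ) = r.  Each determines its last argument uniquely.

  IsDistance : V → V → ℕ → Set
  IsDistance u v d = Walk u v d × (∀ {ℓ} → Walk u v ℓ → d ≤ ℓ)

  IsSetDistance : V → Pred V 0ℓ → ℕ → Set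
  IsSetDistance v S d =
    (∃[ s ] s ∈ S × IsDistance v s d) ×
    (∀ {s e} → s ∈ S → IsDistance v s e → d ≤ e)

  IsRepresentation : ∀ {k} → (Fin k → Pred V 0ℓ) → V → Vec ℕ k → Set
  IsRepresentation S v r = ∀ i → IsSetDistance v (S i) (lookup r i)

  record IsPartition {k : ℕ} (S : Fin k → Pred V 0ℓ) : Set where
    field
      nonempty : ∀ i → Satisfiable (S i)
      disjoint : ∀ {i j} → i ≢ j → S i ⊥ S j
      cover    : ∀ v → ∃[ i ] v ∈ S i

  -- Meant for connected finite graphs, such as T₂ₙ n for n ≥ 1, where
  -- every vertex has a representation with respect to every partition.

  record IsResolvingPartition {k : ℕ} (S : Fin k → Pred V 0ℓ) : Set where
    field
      isPartition : IsPartition S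
      resolving   : ∀ {u v} → u ≢ v → ∀ {r s} →
                    IsRepresentation S u r → IsRepresentation S v s → r ≢ s

-- ⌈√ m ⌉ is the least c with √m ≤ c, that is, with m ≤ c².

⌈√_⌉ : ℕ → ℕ
⌈√ zero ⌉ = 0
⌈√ suc m ⌉ with ⌈√ m ⌉
... | c with suc m ≤? c * c
...   | yes _ = c
...   | no  _ = suc c

⌈√⌉-upper : ∀ m → m ≤ ⌈√ m ⌉ * ⌈√ m ⌉
⌈√⌉-upper zero = z≤n
⌈√⌉-upper (suc m) with ⌈√ m ⌉ | ⌈√⌉-upper m
... | c | ih with suc m ≤? c * c
...   | yes p = p
...   | no  _ = s≤s (≤-trans ih (≤-trans (*-monoʳ-≤ c (n≤1+n c)) (m≤n+m (c * suc c) c)))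

⌈√⌉-least : ∀ m c → m ≤ c * c → ⌈√ m ⌉ ≤ c
⌈√⌉-least zero    c _ = z≤n
⌈√⌉-least (suc m) c p with ⌈√ m ⌉ | ⌈√⌉-least m c (≤-trans (n≤1+n m) p)
... | b | ih with suc m ≤? b * b
...   | yes _ = ih
...   | no ¬q = ≰⇒> λ c≤b → ¬q (≤-trans p (*-mono-≤ c≤b c≤b))

-- 2√m = √(4m)

⌈2√_⌉ : ℕ → ℕ
⌈2√ m ⌉ = ⌈√ 4 * m ⌉

{-# OPTIONS --safe #-}
-- For n even, vertices of T₂ₙ(W) on opposite sides of the parity bipartition
-- are adjacent, and a vertex has exactly one neighbour on its own side, its
-- mate; all other distances are 2.  So v is determined within its side by its
-- class together with the class of its mate, and the latter is visible from v
-- only if it lies within the side.  If a classes lie within the side and c are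
-- mixed, this leaves at most a² + c (a + 1) vertices on it.  Taking the side
-- with the smaller a gives 2a + c ≤ k, and
-- (2a + c)² - 4 (a² + c (a + 1) - 1) = (c - 2)² ≥ 0.
module Submission where

open import Data.Nat using (ℕ; _*_; _∸_; _≤_; _≥_)
open import Data.Nat.Divisibility using (_∣_)
open import Data.Fin using (Fin)
open import Level using (0ℓ)
open import Relation.Unary using (Pred)
open import Defs

open import Data.Fin using (zero; suc; toℕ; cast; combine; remQuot; opposite; _≟_)
import Data.Fin.Properties as Fin
open import Data.List using (List; []; _∷_; _++_; length; map; filter; allFin; cartesianProduct)
import Data.List.Membership.Propositional as List
open import Data.List.Membership.Propositional.Properties
  using (∈-filter⁺; ∈-allFin; ∈-cartesianProduct⁺; ∈-++⁺ˡ; ∈-++⁺ʳ; ∈-map⁺)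
import Data.List.Membership.Setoid.Properties as SetoidMembership
open import Data.List.Properties using (length-++; length-map; length-tabulate)
open import Data.Nat using (zero; suc; _+_; _<_; z≤n; s≤s; ∣_-_∣; parity)
open import Data.Nat.Divisibility using (divides)
open import Data.Nat.Properties
  using (≤-trans; ≤-reflexive; m≤m+n; m≤n⇒m≤1+n; +-suc; +-comm; *-comm; +-identityʳ;
         +-cancelˡ-≡; +-cancelʳ-≤; +-monoˡ-≤; +-monoʳ-≤; *-monoʳ-≤; *-mono-≤; ≤-total; <⇒≤; <⇒≢;
         ≤-<-trans; ⊔-pres-<m; m∸n+n≡m; ∣-∣-comm; m≤n⇒∣m-n∣≡n∸m; ∣m-n∣≤m⊔n; ∣m-m+n∣≡n;
         ∣m+n-m+o∣≡∣n-o∣; ∣n-n∣≡0; module ≤-Reasoning)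
open import Data.Nat.Tactic.RingSolver using (solve-∀)
import Data.Parity as ℙ
open ℙ using (Parity; 0ℙ; 1ℙ; _⁻¹)
open import Data.Parity.Properties using (suc-homo-⁻¹; +-homo-+; *-homo-*; p≢p⁻¹)
open import Data.Product using (_×_; _,_; proj₁; proj₂; ∃-syntax)
open import Data.Sum using (_⊎_; inj₁; inj₂; [_,_]′)
open import Data.Vec using (tabulate)
open import Data.Vec.Properties using (lookup∘tabulate; tabulate-cong)
open import Function using (_∘_; Injective)
open import Relation.Binary.PropositionalEquality
  using (_≡_; _≢_; refl; sym; trans; cong; cong₂; subst; setoid; module ≡-Reasoning)
open import Relation.Nullary using (¬_; Dec; yes; no; contradiction)
open import Relation.Nullary.Decidable using (¬?; _×-dec_; _⊎-dec_; _→-dec_; map′; decidable-stable)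
open import Relation.Unary using (Decidable; _∈_)

-- Counting with lists.

module _ {A : Set} {P Q R : Pred A 0ℓ} (P? : Decidable P) (Q? : Decidable Q) (R? : Decidable R)
         (P⇒¬Q : ∀ {x} → P x → ¬ Q x) (P⇒¬R : ∀ {x} → P x → ¬ R x) (Q⇒¬R : ∀ {x} → Q x → ¬ R x)
         where

  length-filter-disjoint : ∀ xs →
    length (filter P? xs) + (length (filter Q? xs) + length (filter R? xs)) ≤ length xs
  length-filter-disjoint [] = z≤n
  length-filter-disjoint (x ∷ xs) with length-filter-disjoint xs | P? x | Q? x | R? x
  ... | _  | yes p | yes q | _     = contradiction q (P⇒¬Q p)
  ... | _  | yes p | no  _ | yes r = contradiction r (P⇒¬R p)
  ... | _  | no  _ | yes q | yes r = contradiction r (Q⇒¬R q)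
  ... | ih | yes _ | no  _ | no  _ = s≤s ih
  ... | ih | no  _ | yes _ | no  _ = ≤-trans (≤-reflexive (+-suc _ _)) (s≤s ih)
  ... | ih | no  _ | no  _ | yes _ =
    ≤-trans (≤-reflexive (trans (cong (length (filter P? xs) +_) (+-suc _ _)) (+-suc _ _))) (s≤s ih)
  ... | ih | no  _ | no  _ | no  _ = m≤n⇒m≤1+n ih

length-cartesianProduct : ∀ {A B : Set} (xs : List A) (ys : List B) →
  length (cartesianProduct xs ys) ≡ length xs * length ys
length-cartesianProduct []       ys = refl
length-cartesianProduct (x ∷ xs) ys = trans (length-++ (map (x ,_) ys))
  (cong₂ _+_ (length-map (x ,_) ys) (length-cartesianProduct xs ys))

-- The position at which `f i` is found in `xs` determines `f i`, hence `i`, so repetitions in `xs`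
-- do no harm.
injective⇒≤-length : ∀ {A : Set} {n} {f : Fin n → A} {xs} →
  Injective _≡_ _≡_ f → (∀ i → f i List.∈ xs) → n ≤ length xs
injective⇒≤-length {A} f-inj f∈xs = Fin.injective⇒≤ λ {i} {j} eq →
  f-inj (SetoidMembership.index-injective (setoid A) (f∈xs i) (f∈xs j) eq)

-- Parity arithmetic.

p+q≡0ℙ⇒p≡q : ∀ p q → p ℙ.+ q ≡ 0ℙ → p ≡ q
p+q≡0ℙ⇒p≡q 0ℙ 0ℙ _ = refl
p+q≡0ℙ⇒p≡q 1ℙ 1ℙ _ = refl

p+p≡0ℙ : ∀ p → p ℙ.+ p ≡ 0ℙ
p+p≡0ℙ 0ℙ = refl
p+p≡0ℙ 1ℙ = refl

p⁻¹+q⁻¹≡p+q : ∀ p q → p ⁻¹ ℙ.+ q ⁻¹ ≡ p ℙ.+ q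
p⁻¹+q⁻¹≡p+q 0ℙ 0ℙ = refl
p⁻¹+q⁻¹≡p+q 0ℙ 1ℙ = refl
p⁻¹+q⁻¹≡p+q 1ℙ 0ℙ = refl
p⁻¹+q⁻¹≡p+q 1ℙ 1ℙ = refl

2∣n⇒parity≡0ℙ : ∀ {n} → 2 ∣ n → parity n ≡ 0ℙ
2∣n⇒parity≡0ℙ (divides q refl) = trans (cong parity (*-comm q 2)) (*-homo-* 2 q)

parity≡0ℙ⇒2∣n : ∀ n → parity n ≡ 0ℙ → 2 ∣ n
parity≡0ℙ⇒2∣n zero          _  = divides 0 refl
parity≡0ℙ⇒2∣n (suc (suc n)) eq with parity≡0ℙ⇒2∣n n eq
... | divides q refl = divides (suc q) refl

-- Lowering both arguments by one flips both parities, which leaves their sum unchanged.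
parity-∣-∣ : ∀ m n → parity ∣ m - n ∣ ≡ parity m ℙ.+ parity n
parity-∣-∣ zero    n       = refl
parity-∣-∣ (suc m) zero    = trans (cong parity (sym (+-identityʳ (suc m)))) (+-homo-+ (suc m) 0)
parity-∣-∣ (suc m) (suc n) = begin
  parity ∣ m - n ∣                        ≡⟨ parity-∣-∣ m n ⟩
  parity m ℙ.+ parity n                   ≡⟨ cong₂ ℙ._+_ (suc-homo-⁻¹ m) (suc-homo-⁻¹ n) ⟨
  parity (suc m) ⁻¹ ℙ.+ parity (suc n) ⁻¹ ≡⟨ p⁻¹+q⁻¹≡p+q (parity (suc m)) (parity (suc n)) ⟩
  parity (suc m) ℙ.+ parity (suc n)       ∎
  where open ≡-Reasoning

-- Resolving partitions of graphs of diameter at most two.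

module DiameterTwo
  {N : ℕ} (G : SimpleGraph (Fin N))
  (adjacent? : ∀ u v → Dec (SimpleGraph._~_ G u v))
  (midpoint : ∀ {u v} → ¬ SimpleGraph._~_ G u v →
              ∃[ w ] SimpleGraph._~_ G u w × SimpleGraph._~_ G w v)
  {k : ℕ} {S : Fin k → Pred (Fin N) 0ℓ} (R : IsResolvingPartition G S)
  where

  open SimpleGraph G
  open IsResolvingPartition R
  open IsPartition isPartition

  color : Fin N → Fin k
  color v = proj₁ (cover v)

  ∈⇒color≡ : ∀ {v i} → v ∈ S i → color v ≡ i
  ∈⇒color≡ {v} {i} v∈Sᵢ = decidable-stable (color v ≟ i) λ ≢i →
    disjoint ≢i (proj₂ (cover v) , v∈Sᵢ)

  color≡⇒∈ : ∀ {v i} → color v ≡ i → v ∈ S i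
  color≡⇒∈ {v} refl = proj₂ (cover v)

  Touches : Fin N → Fin k → Set
  Touches v i = ∃[ s ] color s ≡ i × v ~ s

  touches? : ∀ v i → Dec (Touches v i)
  touches? v i = Fin.any? λ s → (color s ≟ i) ×-dec (adjacent? v s)

  -- The distance to a class in closed form. The class of `v` itself is tested first, so whether `v`
  -- touches its own class leaves no trace.
  dist : Fin N → Fin k → ℕ
  dist v i with color v ≟ i | touches? v i
  ... | yes _ | _     = 0
  ... | no  _ | yes _ = 1
  ... | no  _ | no  _ = 2

  private
    fromWalk : ∀ {v i d s} → s ∈ S i → Walk G v s d →
               (∀ {s′ ℓ} → s′ ∈ S i → Walk G v s′ ℓ → d ≤ ℓ) → IsSetDistance G v (S i) d
    fromWalk s∈ w shortest = (_ , s∈ , w , shortest s∈) , λ s′∈ (w′ , _) → shortest s′∈ w′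

  dist-isSetDistance : ∀ v i → IsSetDistance G v (S i) (dist v i)
  dist-isSetDistance v i with color v ≟ i | touches? v i
  ... | yes eq | _ = fromWalk (color≡⇒∈ eq) [] λ _ _ → z≤n
  ... | no ≢i | yes (s , eq , v~s) = fromWalk (color≡⇒∈ eq) (v~s ∷ []) λ where
    v∈ []      → contradiction (∈⇒color≡ v∈) ≢i
    _  (_ ∷ _) → s≤s z≤n
  -- Any member `s` of the class serves: it is not adjacent to `v`, so a midpoint gives a walk of
  -- length 2.
  ... | no ≢i | no ¬t = let s , s∈ = nonempty i
                            w , v~w , w~s = midpoint λ v~s → ¬t (s , ∈⇒color≡ s∈ , v~s)
    in fromWalk s∈ (v~w ∷ (w~s ∷ [])) λ where
      v∈ []            → contradiction (∈⇒color≡ v∈) ≢i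
      s∈ (v~s ∷ [])    → contradiction (_ , ∈⇒color≡ s∈ , v~s) ¬t
      _  (_ ∷ (_ ∷ _)) → s≤s (s≤s z≤n)

  dist-cong : ∀ {u v i} → color u ≡ color v →
    (i ≢ color u → Touches u i → Touches v i) →
    (i ≢ color v → Touches v i → Touches u i) → dist u i ≡ dist v i
  dist-cong {u} {v} {i} eq u⇒v v⇒u with color u ≟ i | color v ≟ i | touches? u i | touches? v i
  ... | yes _  | yes _  | _     | _     = refl
  ... | yes ≡i | no  ≢i | _     | _     = contradiction (trans (sym eq) ≡i) ≢i
  ... | no  ≢i | yes ≡i | _     | _     = contradiction (trans eq ≡i) ≢i
  ... | no  _  | no  _  | yes _ | yes _ = refl
  ... | no  ≢i | no  _  | yes t | no ¬t = contradiction (u⇒v (≢i ∘ sym) t) ¬t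
  ... | no  _  | no  ≢i | no ¬t | yes t = contradiction (v⇒u (≢i ∘ sym) t) ¬t
  ... | no  _  | no  _  | no  _ | no  _ = refl

  -- Vertices of one class that touch the same other classes have equal representations, which a
  -- resolving partition forbids for distinct vertices.
  touches-separates : ∀ {u v} → color u ≡ color v →
    (∀ {i} → i ≢ color u → Touches u i → Touches v i) →
    (∀ {i} → i ≢ color v → Touches v i → Touches u i) → u ≡ v
  touches-separates {u} {v} eq u⇒v v⇒u = decidable-stable (u ≟ v) λ u≢v →
    resolving u≢v (represent u) (represent v) (tabulate-cong λ i → dist-cong eq u⇒v v⇒u)
    where
    represent : ∀ w → IsRepresentation G S w (tabulate (dist w))
    represent w i = subst (IsSetDistance G w (S i)) (sym (lookup∘tabulate (dist w) i))
                      (dist-isSetDistance w i)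

-- Complete bipartite graphs with mates.

record IsMatchedBiclique (n : ℕ) {N : ℕ} (G : SimpleGraph (Fin N)) : Set where
  open SimpleGraph G
  field
    side            : Fin N → Parity
    mate            : Fin N → Fin N
    cross           : ∀ {u v} → side u ≢ side v → u ~ v
    mated           : ∀ v → v ~ mate v
    cross⊎mated     : ∀ {u v} → u ~ v → side u ≢ side v ⊎ mate u ≡ v
    -- With the next two fields, this gives at least `n` vertices on each side.
    on              : Parity → Fin n → Fin N
    side-on         : ∀ p i → side (on p i) ≡ p
    on-injective    : ∀ p {i j} → on p i ≡ on p j → i ≡ j

module _ {n N : ℕ} {G : SimpleGraph (Fin N)} (B : IsMatchedBiclique n G) where
  open SimpleGraph G
  open IsMatchedBiclique B

  biclique-~? : ∀ u v → Dec (u ~ v)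
  biclique-~? u v = map′ [ cross , (λ { refl → mated u }) ]′ cross⊎mated
    (¬? (side u ℙ.≟ side v) ⊎-dec (mate u ≟ v))

  -- Nonadjacent vertices lie on the same side, so any vertex of the opposite side is adjacent to
  -- both; the argument in `Fin n` supplies one.
  biclique-midpoint : Fin n → ∀ {u v} → ¬ u ~ v → ∃[ w ] u ~ w × w ~ v
  biclique-midpoint i {u} {v} u≁v = w , cross u≢w , ~-sym (cross (u≢w ∘ trans u≡v))
    where
    w = on (side u ⁻¹) i
    u≢w : side u ≢ side w
    u≢w eq = p≢p⁻¹ (side u) (trans eq (side-on _ i))
    u≡v : side u ≡ side v
    u≡v = decidable-stable (side u ℙ.≟ side v) (u≁v ∘ cross)

  -- Counting the vertices of a side by their codes.

  module Classes (i₀ : Fin n) {k : ℕ} {S : Fin k → Pred (Fin N) 0ℓ} (R : IsResolvingPartition G S) where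
    open DiameterTwo G biclique-~? (biclique-midpoint i₀) R
    open IsPartition (IsResolvingPartition.isPartition R)

    Within : Parity → Fin k → Set
    Within p i = ∀ v → color v ≡ i → side v ≡ p

    within? : ∀ p → Decidable (Within p)
    within? p i = Fin.all? λ v → (color v ≟ i) →-dec (side v ℙ.≟ p)

    Mixed : Fin k → Set
    Mixed i = ¬ Within 0ℙ i × ¬ Within 1ℙ i

    mixed? : Decidable Mixed
    mixed? i = ¬? (within? 0ℙ i) ×-dec ¬? (within? 1ℙ i)

    pure : Parity → List (Fin k)
    pure p = filter (within? p) (allFin k)

    mixed : List (Fin k)
    mixed = filter mixed? (allFin k)

    length-pure-mixed : length (pure 0ℙ) + (length (pure 1ℙ) + length mixed) ≤ k
    length-pure-mixed = ≤-trans
      (length-filter-disjoint (within? 0ℙ) (within? 1ℙ) mixed? 0⇒¬1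
        (λ w m → proj₁ m w) (λ w m → proj₂ m w) (allFin k))
      (≤-reflexive (length-tabulate {n = k} (λ i → i)))
      where
      -- A class within both sides would be empty.
      0⇒¬1 : ∀ {i} → Within 0ℙ i → ¬ Within 1ℙ i
      0⇒¬1 {i} w₀ w₁ with nonempty i
      ... | v , v∈ with () ← trans (sym (w₀ v (∈⇒color≡ v∈))) (w₁ v (∈⇒color≡ v∈))

    -- The class contains `v`, so the only side it could lie within is that of `v`.
    ¬within⇒mixed : ∀ {v} → ¬ Within (side v) (color v) → Mixed (color v)
    ¬within⇒mixed {v} ¬w = avoid 0ℙ , avoid 1ℙ
      where
      avoid : ∀ p → ¬ Within p (color v)
      avoid p w = ¬w (subst (λ q → Within q (color v)) (sym (w v refl)) w)

    -- Such a class has a member across from `v`. It is therefore touched by every vertex on the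
    -- side of `v` and cannot tell two of them apart.
    ¬within⇒touches : ∀ {v i} → ¬ Within (side v) i → Touches v i
    ¬within⇒touches {v} {i} ¬w
      with Fin.¬∀⟶∃¬ N _ (λ u → (color u ≟ i) →-dec (side u ℙ.≟ side v)) ¬w
    ... | u , ¬imp = u , decidable-stable (color u ≟ i) (λ ≢i → ¬imp λ ≡i → contradiction ≡i ≢i) ,
                     cross λ eq → ¬imp λ _ → sym eq

    touches⇒ : ∀ {v i} → Touches v i → ¬ Within (side v) i ⊎ color (mate v) ≡ i
    touches⇒ (s , eq , v~s) with cross⊎mated v~s
    ... | inj₁ ≢s   = inj₁ λ w → ≢s (sym (w s eq))
    ... | inj₂ refl = inj₂ eq

    -- The default color v marks that the class of the mate is invisible from v.
    hint : Fin N → Fin k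
    hint v with within? (side v) (color (mate v))
    ... | yes _ = color (mate v)
    ... | no  _ = color v

    hint-within : ∀ {v} → Within (side v) (color (mate v)) → hint v ≡ color (mate v)
    hint-within {v} w with within? (side v) (color (mate v))
    ... | yes _  = refl
    ... | no  ¬w = contradiction w ¬w

    hint-cases : ∀ v → (Within (side v) (hint v) × hint v ≡ color (mate v)) ⊎ hint v ≡ color v
    hint-cases v with within? (side v) (color (mate v))
    ... | yes w = inj₁ (w , refl)
    ... | no  _ = inj₂ refl

    -- A class that leaves the side is touched by `u` and `v` alike. A class within the side can be
    -- touched only through the mate, and then the hint names it.
    touches-transfer : ∀ {u v} → side u ≡ side v → color u ≡ color v → hint u ≡ hint v →
      ∀ {i} → i ≢ color u → Touches u i → Touches v i
    touches-transfer {u} {v} side≡ color≡ hint≡ {i} i≢ t with within? (side u) i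
    ... | no ¬w = ¬within⇒touches (subst (λ p → ¬ Within p i) side≡ ¬w)
    ... | yes w with touches⇒ t
    ...   | inj₁ ¬w   = contradiction w ¬w
    ...   | inj₂ refl with hint-cases v
    ...     | inj₁ (_ , eq) = mate v , trans (sym eq) (trans (sym hint≡) (hint-within w)) , mated v
    -- Here `v` has the default hint, so `i` = `hint u` = `hint v` = `color v` = `color u`, and this
    -- value of `i` is excluded.
    ...     | inj₂ eq       =
      contradiction (trans (sym (hint-within w)) (trans hint≡ (trans eq (sym color≡)))) i≢

    code : Fin N → Fin k × Fin k
    code v = color v , hint v

    code-injective : ∀ {u v} → side u ≡ side v → code u ≡ code v → u ≡ v
    code-injective side≡ code≡ = touches-separates color≡
      (touches-transfer side≡ color≡ hint≡)
      (touches-transfer (sym side≡) (sym color≡) (sym hint≡))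
      where
      color≡ = cong proj₁ code≡
      hint≡  = cong proj₂ code≡

    -- For a class within the side the default hint is itself a class within the side, so the first
    -- product already contains that pair. Only mixed classes need the extra diagonal pairs, whence
    -- a² + ca + c.
    codes : Parity → List (Fin k × Fin k)
    codes p = cartesianProduct (pure p) (pure p) ++
              cartesianProduct mixed (pure p) ++ map (λ i → i , i) mixed

    length-codes : ∀ p → let a = length (pure p); c = length mixed in
                   length (codes p) ≡ a * a + (c * a + c)
    length-codes p = trans (length-++ (cartesianProduct (pure p) (pure p)))
      (cong₂ _+_ (length-cartesianProduct (pure p) (pure p))
        (trans (length-++ (cartesianProduct mixed (pure p)))
          (cong₂ _+_ (length-cartesianProduct mixed (pure p)) (length-map _ mixed))))

    code∈codes : ∀ v → code v List.∈ codes (side v)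
    code∈codes v with within? (side v) (color v) | hint-cases v
    ... | yes w | inj₁ (w′ , _) = ∈-++⁺ˡ (∈-cartesianProduct⁺
            (∈-filter⁺ (within? (side v)) (∈-allFin _) w)
            (∈-filter⁺ (within? (side v)) (∈-allFin _) w′))
    ... | yes w | inj₂ eq rewrite eq = ∈-++⁺ˡ (∈-cartesianProduct⁺
            (∈-filter⁺ (within? (side v)) (∈-allFin _) w)
            (∈-filter⁺ (within? (side v)) (∈-allFin _) w))
    ... | no ¬w | inj₁ (w′ , _) = ∈-++⁺ʳ (cartesianProduct (pure (side v)) (pure (side v)))
            (∈-++⁺ˡ (∈-cartesianProduct⁺
              (∈-filter⁺ mixed? (∈-allFin _) (¬within⇒mixed ¬w))
              (∈-filter⁺ (within? (side v)) (∈-allFin _) w′)))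
    ... | no ¬w | inj₂ eq rewrite eq = ∈-++⁺ʳ (cartesianProduct (pure (side v)) (pure (side v)))
            (∈-++⁺ʳ (cartesianProduct mixed (pure (side v)))
              (∈-map⁺ (λ i → i , i) (∈-filter⁺ mixed? (∈-allFin _) (¬within⇒mixed ¬w))))

    -- The vertices `on p i` are distinct and share a side, so their codes are distinct entries of
    -- `codes p`.
    side-bound : ∀ p → let a = length (pure p); c = length mixed in n ≤ a * a + (c * a + c)
    side-bound p = ≤-trans
      (injective⇒≤-length {f = code ∘ on p}
        (λ eq → on-injective p (code-injective (trans (side-on p _) (sym (side-on p _))) eq))
        (λ i → subst (λ q → code (on p i) List.∈ codes q) (side-on p i) (code∈codes (on p i))))
      (≤-reflexive (length-codes p))

-- From the count to the square root.

4c≤c²+4 : ∀ c → 4 * c ≤ c * c + 4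
4c≤c²+4 0 = z≤n
4c≤c²+4 1 = s≤s (s≤s (s≤s (s≤s z≤n)))
-- With c = d + 2 the square (c - 2)² becomes `d * d`, free of subtraction.
4c≤c²+4 (suc (suc d)) = ≤-trans (m≤m+n (4 * suc (suc d)) (d * d)) (≤-reflexive (square d))
  where
  square : ∀ d → 4 * (2 + d) + d * d ≡ (2 + d) * (2 + d) + 4
  square = solve-∀

4[n-1]≤k² : ∀ {n k} a b c → n ≤ a * a + (c * a + c) → a ≤ b → a + (b + c) ≤ k → 4 * (n ∸ 1) ≤ k * k
4[n-1]≤k² {zero}      a b c _   _   _   = z≤n
-- Adding 4 to both sides makes room for `4c≤c²+4`; what remains is the square of 2a + c.
4[n-1]≤k² {suc n} {k} a b c n≤ a≤b ≤k = +-cancelʳ-≤ 4 (4 * n) (k * k) (begin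
  4 * n + 4                            ≡⟨ shift n ⟩
  4 * suc n                            ≤⟨ *-monoʳ-≤ 4 n≤ ⟩
  4 * (a * a + (c * a + c))            ≡⟨ expand a c ⟩
  4 * (a * a) + 4 * (c * a) + 4 * c    ≤⟨ +-monoʳ-≤ (4 * (a * a) + 4 * (c * a)) (4c≤c²+4 c) ⟩
  4 * (a * a) + 4 * (c * a) + (c * c + 4) ≡⟨ complete a c ⟩
  (a + (a + c)) * (a + (a + c)) + 4    ≤⟨ +-monoˡ-≤ 4 (*-mono-≤ 2a+c≤k 2a+c≤k) ⟩
  k * k + 4                            ∎)
  where
  open ≤-Reasoning
  2a+c≤k = ≤-trans (+-monoʳ-≤ a (+-monoˡ-≤ c a≤b)) ≤k
  shift : ∀ n → 4 * n + 4 ≡ 4 * (1 + n)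
  shift = solve-∀
  expand : ∀ a c → 4 * (a * a + (c * a + c)) ≡ 4 * (a * a) + 4 * (c * a) + 4 * c
  expand = solve-∀
  complete : ∀ a c → 4 * (a * a) + 4 * (c * a) + (c * c + 4) ≡ (a + (a + c)) * (a + (a + c)) + 4
  complete = solve-∀

biclique-bound : ∀ {n N} {G : SimpleGraph (Fin N)} → IsMatchedBiclique n G → Fin n →
  ∀ {k} {S : Fin k → Pred (Fin N) 0ℓ} → IsResolvingPartition G S → ⌈2√ n ∸ 1 ⌉ ≤ k
-- By minimality of the rounded root it suffices that 4(n - 1) ≤ k². The case split selects the side
-- with fewer classes within it.
biclique-bound {n} B i₀ {k} R = ⌈√⌉-least (4 * (n ∸ 1)) k
  ([ (λ a≤b → 4[n-1]≤k² a b c (side-bound 0ℙ) a≤b length-pure-mixed)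
   , (λ b≤a → 4[n-1]≤k² b a c (side-bound 1ℙ) b≤a (≤-trans (≤-reflexive (swap b a c)) length-pure-mixed))
   ]′ (≤-total a b))
  where
  open Classes B i₀ R
  a = length (pure 0ℙ)
  b = length (pure 1ℙ)
  c = length mixed
  swap : ∀ x y z → x + (y + z) ≡ y + (x + z)
  swap = solve-∀

-- Antipodes and parity classes in the Toeplitz graph.

∣b-n+b′∣≡n⇒b≡b′ : ∀ {n b b′} → b < n → ∣ b - n + b′ ∣ ≡ n → b ≡ b′
-- The bars enclose b - (n + b′). Since b < n, the absolute value is n + b′ - b.
∣b-n+b′∣≡n⇒b≡b′ {n} {b} {b′} b<n eq = sym (+-cancelˡ-≡ n b′ b (begin
  n + b′              ≡⟨ m∸n+n≡m b≤n+b′ ⟨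
  (n + b′ ∸ b) + b    ≡⟨ cong (_+ b) (trans (sym (m≤n⇒∣m-n∣≡n∸m b≤n+b′)) eq) ⟩
  n + b               ∎))
  where
  open ≡-Reasoning
  b≤n+b′ = ≤-trans (<⇒≤ b<n) (m≤m+n n b′)

module _ (n : ℕ) where

  -- An index is split as a * n + b with a in `Fin 2`; swapping the two halves moves it by exactly
  -- `n`.
  antipode : Fin (2 * n) → Fin (2 * n)
  antipode v = let a , b = remQuot {2} n v in combine (opposite a) b

  antipode-combine : ∀ (a : Fin 2) (b : Fin n) → antipode (combine a b) ≡ combine (opposite a) b
  antipode-combine a b = cong (λ (a , b) → combine (opposite a) b) (Fin.remQuot-combine {2} a b)

  toℕ-lower : ∀ (b : Fin n) → toℕ (combine {2} zero b) ≡ toℕ b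
  toℕ-lower b = trans (Fin.toℕ-combine {2} zero b) (cong (_+ toℕ b) (*-comm n 0))

  toℕ-upper : ∀ (b : Fin n) → toℕ (combine {2} (suc zero) b) ≡ n + toℕ b
  toℕ-upper b = trans (Fin.toℕ-combine {2} (suc zero) b)
    (cong (_+ toℕ b) (trans (*-comm n 1) (+-identityʳ n)))

  antipode-distance : ∀ v → ∣ toℕ v - toℕ (antipode v) ∣ ≡ n
  antipode-distance v with Fin.combine-surjective {2} {n} v
  ... | zero     , b , refl rewrite antipode-combine zero b | toℕ-lower b | toℕ-upper b
                                  | +-comm n (toℕ b) = ∣m-m+n∣≡n (toℕ b) n
  ... | suc zero , b , refl rewrite antipode-combine (suc zero) b | toℕ-lower b | toℕ-upper b
                                  | ∣-∣-comm (n + toℕ b) (toℕ b)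
                                  | +-comm n (toℕ b) = ∣m-m+n∣≡n (toℕ b) n

  -- Indices in the same half differ by less than `n`; indices in different halves differ by `n`
  -- only if their offsets agree.
  antipode-unique : ∀ u v → ∣ toℕ u - toℕ v ∣ ≡ n → antipode u ≡ v
  antipode-unique u v eq with Fin.combine-surjective {2} {n} u | Fin.combine-surjective {2} {n} v
  ... | a , b , refl | a′ , b′ , refl = trans (antipode-combine a b) (cases a a′ eq)
    where
    close : ∣ toℕ b - toℕ b′ ∣ ≢ n
    close = <⇒≢ (≤-<-trans (∣m-n∣≤m⊔n (toℕ b) (toℕ b′)) (⊔-pres-<m (Fin.toℕ<n b) (Fin.toℕ<n b′)))
    cases : ∀ (a a′ : Fin 2) → ∣ toℕ (combine a b) - toℕ (combine a′ b′) ∣ ≡ n →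
            combine (opposite a) b ≡ combine a′ b′
    cases zero zero eq rewrite toℕ-lower b | toℕ-lower b′ = contradiction eq close
    cases (suc zero) (suc zero) eq rewrite toℕ-upper b | toℕ-upper b′ =
      contradiction (trans (sym (∣m+n-m+o∣≡∣n-o∣ n (toℕ b) (toℕ b′))) eq) close
    cases zero (suc zero) eq rewrite toℕ-lower b | toℕ-upper b′ =
      cong (combine {2} (suc zero)) (Fin.toℕ-injective (∣b-n+b′∣≡n⇒b≡b′ (Fin.toℕ<n b) eq))
    cases (suc zero) zero eq rewrite toℕ-upper b | toℕ-lower b′ | ∣-∣-comm (n + toℕ b) (toℕ b′) =
      cong (combine {2} zero) (sym (Fin.toℕ-injective (∣b-n+b′∣≡n⇒b≡b′ (Fin.toℕ<n b′) eq)))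

  bit : Parity → Fin 2
  bit 0ℙ = zero
  bit 1ℙ = suc zero

  -- The vertex whose `toℕ` is 2i or 2i + 1, according to the parity.
  withParity : Parity → Fin n → Fin (2 * n)
  withParity p i = cast (*-comm n 2) (combine i (bit p))

  parity-withParity : ∀ p i → parity (toℕ (withParity p i)) ≡ p
  parity-withParity p i = begin
    parity (toℕ (withParity p i))                      ≡⟨ cong parity (Fin.toℕ-cast (*-comm n 2) (combine i (bit p))) ⟩
    parity (toℕ (combine i (bit p)))                   ≡⟨ cong parity (Fin.toℕ-combine i (bit p)) ⟩
    parity (2 * toℕ i + toℕ (bit p))                   ≡⟨ +-homo-+ (2 * toℕ i) (toℕ (bit p)) ⟩
    parity (2 * toℕ i) ℙ.+ parity (toℕ (bit p))        ≡⟨ cong (ℙ._+ parity (toℕ (bit p))) (*-homo-* 2 (toℕ i)) ⟩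
    parity (toℕ (bit p))                               ≡⟨ parity-bit p ⟩
    p                                                  ∎
    where
    open ≡-Reasoning
    parity-bit : ∀ p → parity (toℕ (bit p)) ≡ p
    parity-bit 0ℙ = refl
    parity-bit 1ℙ = refl

  withParity-injective : ∀ p {i j} → withParity p i ≡ withParity p j → i ≡ j
  withParity-injective p {i} {j} eq = Fin.combine-injectiveˡ i (bit p) j (bit p)
    (Fin.toℕ-injective (trans (sym (Fin.toℕ-cast (*-comm n 2) (combine i (bit p))))
      (trans (cong toℕ eq) (Fin.toℕ-cast (*-comm n 2) (combine j (bit p))))))

-- An odd index difference means opposite parities, and a difference of `n` means antipodes.
-- Positivity of `n` keeps a vertex from being its own antipode.
T₂ₙ-isMatchedBiclique : ∀ n → 0 < n → IsMatchedBiclique n (T₂ₙ n)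
T₂ₙ-isMatchedBiclique n 0<n = record
  { side            = parity ∘ toℕ
  ; mate            = antipode n
  ; cross           = λ {u} {v} ≢s → ≢s ∘ cong (parity ∘ toℕ) , inj₁ λ 2∣d →
      ≢s (p+q≡0ℙ⇒p≡q _ _ (trans (sym (parity-∣-∣ (toℕ u) (toℕ v))) (2∣n⇒parity≡0ℙ 2∣d)))
  ; mated           = λ v → (λ eq → <⇒≢ 0<n (trans (sym (∣n-n∣≡0 (toℕ v)))
      (subst (λ w → ∣ toℕ v - toℕ w ∣ ≡ n) (sym eq) (antipode-distance n v)))) ,
      inj₂ (antipode-distance n v)
  ; cross⊎mated     = cross⊎mated
  ; on              = withParity n
  ; side-on         = parity-withParity n
  ; on-injective    = withParity-injective n
  }
  where
  cross⊎mated : ∀ {u v} → SimpleGraph._~_ (T₂ₙ n) u v →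
                parity (toℕ u) ≢ parity (toℕ v) ⊎ antipode n u ≡ v
  cross⊎mated {u} {v} (_ , inj₁ 2∤d) = inj₁ λ eq → 2∤d (parity≡0ℙ⇒2∣n _
    (trans (parity-∣-∣ (toℕ u) (toℕ v))
      (trans (cong (ℙ._+ parity (toℕ v)) eq) (p+p≡0ℙ (parity (toℕ v))))))
  cross⊎mated {u} {v} (_ , inj₂ d≡n) = inj₂ (antipode-unique n u v d≡n)

theorem3p11 : ∀ (n : ℕ) → n ≥ 4 → 2 ∣ n →
    ∀ (k : ℕ) (S : Fin k → Pred (Fin (2 * n)) 0ℓ) →
    IsResolvingPartition (T₂ₙ n) S → k ≥ ⌈2√ n ∸ 1 ⌉
theorem3p11 (suc n) _ _ k S R =
  biclique-bound (T₂ₙ-isMatchedBiclique (suc n) (s≤s z≤n)) zero R
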